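{- The following two statements (1) and (2), about number fields $\mathbb{K}_1\subseteq\mathbb{K}$ with $m=[\mathbb{K}:\mathbb{K}_1]$ and a prime number $p$, are not equivalent in general; that is, there exist number fields $\mathbb{K}_1\subseteq\mathbb{K}$ and a prime $p$ for which exactly one of them holds: (1) $m\,v_p(i(\mathbb{K}_1))=v_p(i(\mathbb{K}))$. (2) For every algebraic integer $\beta$ of $\mathbb{K}$, if $v_p(i(\beta))=v_p(i(\mathbb{K}))$, then there exists an algebraic integer $\alpha$ of $\mathbb{K}_1$ such that $\beta\equiv\alpha \pmod p$.
   Context: Here $v_p$ is the $p$-adic valuation, and $\beta\equiv\alpha\pmod p$ means $\beta-\alpha\in p\mathbb{A}$ with $\mathbb{A}$ the ring of integers of $\mathbb{K}$. For a number field $\mathbb{K}$ of degree $n$ over $\mathbb{Q}$ with ring of integers $\mathbb{A}$, let $\widehat{\mathbb{A}}$ be the set of $\theta\in\mathbb{A}$ that are primitive over $\mathbb{Q}$, i.e. $\mathbb{K}=\mathbb{Q}(\theta)$. For $\theta\in\mathbb{A}$ let $F_\theta(x)\in\mathbb{Z}[x]$ be the (degree $n$) characteristic polynomial of $\theta$ over $\mathbb{Q}$ (relative to the extension $\mathbb{K}/\mathbb{Q}$) and set $i(\theta)=\gcd_{x\in\mathbb{Z}}F_\theta(x)$. Define $i(\mathbb{K})=\operatorname{lcm}_{\theta\in\widehat{\mathbb{A}}}\, i(\theta)$; $i(\mathbb{K}_1)$ is defined in the same way for the field $\mathbb{K}_1$. -}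

module Defs where

open import Algebra.Apartness.Bundles using (HeytingField; module HeytingCommutativeRing)
open import Algebra.Bundles using (CommutativeRing)
open import Algebra.Bundles.Raw using (RawRing)
open import Algebra.Morphism.Structures using (IsRingHomomorphism; IsRingMonomorphism)
import Algebra.Definitions.RawMonoid as Sum
open import Data.Bool.Base using (if_then_else_)
open import Data.Fin.Base using (Fin; zero; suc; toℕ; punchIn)
open import Data.Fin.Properties using () renaming (_≟_ to _≟ᶠ_)
open import Data.Integer.Base as ℤ using (ℤ; +_)
open import Data.List.Base using (List; []; _∷_; _++_; [_]; map; foldr)
open import Data.Nat.Base using (ℕ; zero; suc; _^_)
open import Data.Nat.Divisibility using (_∣_; _∣?_)
open import Data.Product.Base using (∃; ∃-syntax; _×_; proj₁)
open import Data.Rational.Base as ℚ using (ℚ)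
import Data.Rational.Properties as ℚ
open import Data.Sum.Base using (_⊎_)
open import Data.Vec.Functional using (Vector)
open import Level using (0ℓ)
open import Relation.Binary.PropositionalEquality using (_≡_)
open import Relation.Nullary.Decidable.Core using (does)
open import Relation.Nullary.Negation.Core using (¬_)

------------------------------------------------------------------------
-- Natural numbers

IsGCD : (ℕ → Set) → ℕ → Set
IsGCD S g = (∀ n → S n → g ∣ n) × (∀ d → (∀ n → S n → d ∣ n) → d ∣ g)

IsLCM : (ℕ → Set) → ℕ → Set
IsLCM S l = (∀ n → S n → n ∣ l) × (∀ k → (∀ n → S n → n ∣ k) → l ∣ k)

-- The p-adic valuation of n, for p ≥ 2 and n ≥ 1: the largest k ≤ n with
-- p ^ k ∣ n. The bound is harmless because p ^ k ∣ n forces k < p ^ k ≤ n.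
v : ℕ → ℕ → ℕ
v p n = largest n
  where
  largest : ℕ → ℕ
  largest zero    = zero
  largest (suc k) = if does (p ^ suc k ∣? n) then suc k else largest k

ExactlyOne : Set → Set → Set
ExactlyOne A B = (A × ¬ B) ⊎ (¬ A × B)

------------------------------------------------------------------------
-- Polynomials: lists of coefficients, lowest degree first. Trailing
-- zeros are allowed, so equality is equality of all coefficients.

module Polynomial {c ℓ} (R : RawRing c ℓ) where
  open RawRing R

  Poly : Set c
  Poly = List Carrier

  coeff : Poly → ℕ → Carrier
  coeff []      _       = 0#
  coeff (a ∷ f) zero    = a
  coeff (a ∷ f) (suc k) = coeff f k

  _≈ₚ_ : Poly → Poly → Set ℓ
  f ≈ₚ g = ∀ k → coeff f k ≈ coeff g k

  _+ₚ_ : Poly → Poly → Poly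
  []      +ₚ g       = g
  (a ∷ f) +ₚ []      = a ∷ f
  (a ∷ f) +ₚ (b ∷ g) = (a + b) ∷ (f +ₚ g)

  _*ₚ_ : Poly → Poly → Poly
  []      *ₚ g = []
  (a ∷ f) *ₚ g = map (a *_) g +ₚ (0# ∷ (f *ₚ g))

  polyRawRing : RawRing c ℓ
  polyRawRing = record
    { Carrier = Poly
    ; _≈_     = _≈ₚ_
    ; _+_     = _+ₚ_
    ; _*_     = _*ₚ_
    ; -_      = map (-_)
    ; 0#      = []
    ; 1#      = [ 1# ]
    }

  X : Poly
  X = 0# ∷ 1# ∷ []

  eval : Poly → Carrier → Carrier
  eval f x = foldr (λ a r → a + x * r) 0# f

module ℤ[x] = Polynomial ℤ.+-*-rawRing
module ℚ[x] = Polynomial ℚ.+-*-rawRing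

ℤ→ℚ : ℤ → ℚ
ℤ→ℚ z = z ℚ./ 1

------------------------------------------------------------------------
-- Determinants, by Laplace expansion along the first row

Matrix : ∀ {c} → Set c → ℕ → Set c
Matrix A n = Fin n → Fin n → A

module Determinant {c ℓ} (R : RawRing c ℓ) where
  open RawRing R

  alternate : ℕ → Carrier → Carrier
  alternate zero    x = x
  alternate (suc k) x = - alternate k x

  det : ∀ {n} → Matrix Carrier n → Carrier
  det {zero}  M = 1#
  det {suc n} M = Sum.sum +-rawMonoid λ j →
    alternate (toℕ j) (M zero j * det λ i k → M (suc i) (punchIn j k))

charPoly : ∀ {n} → Matrix ℚ n → ℚ[x].Poly
charPoly M = det λ i j →
  (if does (i ≟ᶠ j) then ℚ[x].X else []) + (- [ M i j ])
  where
  open RawRing ℚ[x].polyRawRing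
  open Determinant ℚ[x].polyRawRing

------------------------------------------------------------------------
-- Fields and finite extensions

-- A tight apartness relation _#_ for which x # y holds exactly when x - y
-- is invertible; in particular 0# and 1# are distinct.
Field : Set₁
Field = HeytingField 0ℓ 0ℓ 0ℓ

module Field (F : Field) where
  open HeytingCommutativeRing (HeytingField.heytingCommutativeRing F) public
    using (commutativeRing)
  open CommutativeRing commutativeRing public

record Embedding (F E : Field) : Set where
  field
    ⟦_⟧                : Field.Carrier F → Field.Carrier E
    isRingMonomorphism : IsRingMonomorphism (Field.rawRing F) (Field.rawRing E) ⟦_⟧

record IsBasis {F E : Field} (σ : Embedding F E) {n : ℕ}
               (b : Vector (Field.Carrier E) n) : Set where
  open Embedding σ
  private
    module F = Field F
    module E = Field E

  combination : Vector F.Carrier n → E.Carrier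
  combination c = Sum.sum (RawRing.+-rawMonoid E.rawRing) λ i → ⟦ c i ⟧ E.* b i

  field
    independent : ∀ c → combination c E.≈ E.0# → ∀ i → c i F.≈ F.0#
    spanning    : ∀ x → ∃[ c ] combination c E.≈ x

  coordinates : E.Carrier → Vector F.Carrier n
  coordinates x = proj₁ (spanning x)

HasDegree : {F E : Field} → Embedding F E → ℕ → Set
HasDegree {E = E} σ n = ∃ λ (b : Vector (Field.Carrier E) n) → IsBasis σ b

------------------------------------------------------------------------
-- Number fields

-- The ℚ-basis is part of the data, but none of the notions below depend
-- on the choice of it: it is only used to form characteristic polynomials.
record NumberField : Set₁ where
  field
    asField  : Field
    ι       : Embedding ℚ.heytingField asField
    degree  : ℕ
    basis   : Vector (Field.Carrier asField) degree
    isBasis : IsBasis ι basis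

  open Field asField public
  open Embedding ι public using () renaming (⟦_⟧ to fromℚ)
  open IsBasis isBasis public using (coordinates)

  fromℤ : ℤ → Carrier
  fromℤ z = fromℚ (ℤ→ℚ z)

  -- Root of the monic polynomial with integer coefficients f ++ [ 1 ].
  IsIntegral : Carrier → Set
  IsIntegral θ = ∃[ f ] Polynomial.eval rawRing (map fromℤ (f ++ [ + 1 ])) θ ≈ 0#

  -- ℚ(θ), the subfield generated by θ.
  data ℚ⟨_⟩ (θ : Carrier) : Carrier → Set where
    generator : ℚ⟨ θ ⟩ θ
    rational  : ∀ q → ℚ⟨ θ ⟩ (fromℚ q)
    sum       : ∀ {x y} → ℚ⟨ θ ⟩ x → ℚ⟨ θ ⟩ y → ℚ⟨ θ ⟩ (x + y)
    negative  : ∀ {x} → ℚ⟨ θ ⟩ x → ℚ⟨ θ ⟩ (- x)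
    product   : ∀ {x y} → ℚ⟨ θ ⟩ x → ℚ⟨ θ ⟩ y → ℚ⟨ θ ⟩ (x * y)
    inverse   : ∀ {x y} → ℚ⟨ θ ⟩ x → x * y ≈ 1# → ℚ⟨ θ ⟩ y
    resp      : ∀ {x y} → x ≈ y → ℚ⟨ θ ⟩ x → ℚ⟨ θ ⟩ y

  IsPrimitive : Carrier → Set
  IsPrimitive θ = ∀ x → ℚ⟨ θ ⟩ x

  -- Column j holds the coordinates of θ times the j-th basis vector.
  multiplication : Carrier → Matrix ℚ degree
  multiplication θ i j = coordinates (θ * basis j) i

  -- F ∈ ℤ[x] is the characteristic polynomial of θ over ℚ. Such an F exists
  -- for every integral θ.
  IsCharPoly : Carrier → ℤ[x].Poly → Set
  IsCharPoly θ F = map ℤ→ℚ F ℚ[x].≈ₚ charPoly (multiplication θ)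

  -- g = i(θ) = gcd of the values F_θ(x), x ∈ ℤ.
  IsElementIndex : Carrier → ℕ → Set
  IsElementIndex θ g = ∃[ F ] IsCharPoly θ F ×
    IsGCD (λ n → ∃[ x ] n ≡ ℤ.∣ ℤ[x].eval F x ∣) g

  -- l = i(K) = lcm of the i(θ), θ integral and primitive.
  IsFieldIndex : ℕ → Set
  IsFieldIndex l = IsLCM
    (λ g → ∃[ θ ] IsIntegral θ × IsPrimitive θ × IsElementIndex θ g) l

  -- β ≡ α (mod p): β - α ∈ p𝔸.
  _≡_mod_ : Carrier → Carrier → ℕ → Set
  β ≡ α mod p = ∃[ γ ] IsIntegral γ × β - α ≈ fromℤ (+ p) * γ

-- K₁ ⊆ K is presented as an embedding K₁ → K.
record NumberFieldExtension : Set₁ where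
  field
    K₁ K   : NumberField
    σ      : Embedding (NumberField.asField K₁) (NumberField.asField K)
    m      : ℕ
    [K:K₁] : HasDegree σ m

  open Embedding σ public using () renaming (⟦_⟧ to include)
  module K₁ = NumberField K₁
  module K  = NumberField K

{-# OPTIONS --safe #-}
module Submission where

-- Over K₁ = ℚ, condition (2) says that the algebraic integers β of K with
-- v_p(i(β)) = v_p(i(K)) are congruent to rational integers modulo p. Take
-- K = ℚ(√-7) and p = 3. Second differences of a monic quadratic F show
-- i(β) ∣ 2, and θ = (1 + √-7)/2, with F = x² - x + 2, gives i(K) = 2. Hence
-- (1) reads 2 · 0 = 0. But (2) fails for θ: as 3 is inert, no (θ - α)/3 with
-- α ∈ ℚ is integral.

open import Defs
open import Algebra.Bundles using (CommutativeRing)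
open import Algebra.Morphism.Structures using (IsRingMonomorphism)
open import Algebra.Structures using (IsCommutativeRing)
open import Data.Fin.Base using (zero; suc)
open import Data.Integer.Base as ℤ using (ℤ; +_; -[1+_])
open import Data.Integer.Divisibility.Signed using (_∣_; divides; ∣ᵤ⇒∣; ∣⇒∣ᵤ;
  ∣-refl; ∣m∣n⇒∣m+n; ∣m∣n⇒∣m-n; ∣m+n∣m⇒∣n; ∣m⇒∣m*n; ∣n⇒∣m*n)
import Data.Integer.DivMod as ℤ
import Data.Integer.Properties as ℤ
import Data.Integer.Solver as ℤ
open import Data.List.Base using (List; []; _∷_; _++_; [_]; map)
open import Data.Nat.Base as ℕ using (ℕ; zero; suc; _*_)
open import Data.Nat.Coprimality as Coprimality using (Coprime)
import Data.Nat.Divisibility as ℕ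
open import Data.Nat.Primality using (Prime; prime?; euclidsLemma)
open import Data.Product.Base using (Σ; ∃; ∃₂; _×_; _,_; proj₁; proj₂)
open import Data.Product.Properties using (≡-dec)
open import Data.Rational.Base as ℚ using (ℚ; mkℚ; 0ℚ; 1ℚ; ½)
import Data.Rational.Properties as ℚ
import Data.Rational.Solver as ℚ
open import Data.Rational.Unnormalised.Base as ℚᵘ using (mkℚᵘ; *≡*)
import Data.Rational.Unnormalised.Properties as ℚᵘ
open import Data.Sum.Base using (_⊎_; inj₁; inj₂)
open import Data.Vec.Functional using (Vector)
open import Relation.Binary.Bundles using (DecSetoid)
import Relation.Binary.Properties.DecSetoid as DecSetoid
open import Relation.Binary.PropositionalEquality
  using (_≡_; refl; sym; trans; cong; cong₂; subst; module ≡-Reasoning; isEquivalence)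
open import Relation.Binary.PropositionalEquality.Properties using (decSetoid)
open import Relation.Nullary.Decidable using (decidable-stable; from-yes; from-no)
open import Relation.Nullary.Negation using (¬_; contradiction)
open import Algebra.Apartness.Properties.HeytingCommutativeRing
  ℚ.heytingCommutativeRing using (x#0y#0→xy#0)

-- The embedding ℤ → ℚ

-- For a variable `z` the normalised fraction `ℤ→ℚ z` does not reduce. As an unnormalised fraction
-- it is z over 1, and there the homomorphism laws below become integer identities.
toℚᵘ-ℤ→ℚ : ∀ z → ℚ.toℚᵘ (ℤ→ℚ z) ℚᵘ.≃ mkℚᵘ z 0
toℚᵘ-ℤ→ℚ z = ℚ.toℚᵘ-fromℚᵘ (mkℚᵘ z 0)

ℤ→ℚ-injective : ∀ {y z} → ℤ→ℚ y ≡ ℤ→ℚ z → y ≡ z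
ℤ→ℚ-injective {y} {z} eq with ℚ.fromℚᵘ-injective {mkℚᵘ y 0} {mkℚᵘ z 0} eq
... | *≡* y*1≡z*1 = ℤ.*-cancelʳ-≡ y z (+ 1) y*1≡z*1

ℤ→ℚ-+ : ∀ y z → ℤ→ℚ (y ℤ.+ z) ≡ ℤ→ℚ y ℚ.+ ℤ→ℚ z
ℤ→ℚ-+ y z = ℚ.toℚᵘ-injective (begin
  ℚ.toℚᵘ (ℤ→ℚ (y ℤ.+ z))                  ≈⟨ toℚᵘ-ℤ→ℚ (y ℤ.+ z) ⟩
  mkℚᵘ (y ℤ.+ z) 0                        ≈⟨ *≡* (cong (ℤ._* + 1)
    (cong₂ ℤ._+_ (sym (ℤ.*-identityʳ y)) (sym (ℤ.*-identityʳ z)))) ⟩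
  mkℚᵘ y 0 ℚᵘ.+ mkℚᵘ z 0                  ≈⟨ ℚᵘ.+-cong (toℚᵘ-ℤ→ℚ y) (toℚᵘ-ℤ→ℚ z) ⟨
  ℚ.toℚᵘ (ℤ→ℚ y) ℚᵘ.+ ℚ.toℚᵘ (ℤ→ℚ z)      ≈⟨ ℚ.toℚᵘ-homo-+ (ℤ→ℚ y) (ℤ→ℚ z) ⟨
  ℚ.toℚᵘ (ℤ→ℚ y ℚ.+ ℤ→ℚ z)                ∎)
  where open ℚᵘ.≃-Reasoning

ℤ→ℚ-* : ∀ y z → ℤ→ℚ (y ℤ.* z) ≡ ℤ→ℚ y ℚ.* ℤ→ℚ z
ℤ→ℚ-* y z = ℚ.toℚᵘ-injective (begin
  ℚ.toℚᵘ (ℤ→ℚ (y ℤ.* z))                  ≈⟨ toℚᵘ-ℤ→ℚ (y ℤ.* z) ⟩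
  mkℚᵘ y 0 ℚᵘ.* mkℚᵘ z 0                  ≈⟨ ℚᵘ.*-cong (toℚᵘ-ℤ→ℚ y) (toℚᵘ-ℤ→ℚ z) ⟨
  ℚ.toℚᵘ (ℤ→ℚ y) ℚᵘ.* ℚ.toℚᵘ (ℤ→ℚ z)      ≈⟨ ℚ.toℚᵘ-homo-* (ℤ→ℚ y) (ℤ→ℚ z) ⟨
  ℚ.toℚᵘ (ℤ→ℚ y ℚ.* ℤ→ℚ z)                ∎)
  where open ℚᵘ.≃-Reasoning

-- Quadratic algebras over ℚ

Quadratic : Set
Quadratic = ℚ × ℚ

-- The pair `(a , b)` stands for a + b√d. The ring laws hold for every rational `d`, square or not.
module QuadraticAlgebra (d : ℚ) where

  infixl 6 _+_
  infixl 7 _·_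

  _+_ : Quadratic → Quadratic → Quadratic
  (a , b) + (a′ , b′) = a ℚ.+ a′ , b ℚ.+ b′

  _·_ : Quadratic → Quadratic → Quadratic
  (a , b) · (a′ , b′) = a ℚ.* a′ ℚ.+ d ℚ.* (b ℚ.* b′) , a ℚ.* b′ ℚ.+ b ℚ.* a′

  -_ : Quadratic → Quadratic
  - (a , b) = ℚ.- a , ℚ.- b

  0# 1# : Quadratic
  0# = 0ℚ , 0ℚ
  1# = 1ℚ , 0ℚ

  -- The product of a + b√d with its conjugate a - b√d.
  norm : Quadratic → ℚ
  norm (a , b) = a ℚ.* a ℚ.- d ℚ.* (b ℚ.* b)

  ·-comm : ∀ x y → x · y ≡ y · x
  ·-comm (a , b) (a′ , b′) = cong₂ _,_
    (solve 5 (λ d a b a′ b′ → a :* a′ :+ d :* (b :* b′) := a′ :* a :+ d :* (b′ :* b)) refl d a b a′ b′)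
    (solve 4 (λ a b a′ b′ → a :* b′ :+ b :* a′ := a′ :* b :+ b′ :* a) refl a b a′ b′)
    where open ℚ.+-*-Solver

  ·-assoc : ∀ x y z → (x · y) · z ≡ x · (y · z)
  ·-assoc (a , b) (a′ , b′) (a″ , b″) = cong₂ _,_
    (solve 7 (λ d a b a′ b′ a″ b″ →
      (a :* a′ :+ d :* (b :* b′)) :* a″ :+ d :* ((a :* b′ :+ b :* a′) :* b″) :=
      a :* (a′ :* a″ :+ d :* (b′ :* b″)) :+ d :* (b :* (a′ :* b″ :+ b′ :* a″))) refl d a b a′ b′ a″ b″)
    (solve 7 (λ d a b a′ b′ a″ b″ →
      (a :* a′ :+ d :* (b :* b′)) :* b″ :+ (a :* b′ :+ b :* a′) :* a″ :=
      a :* (a′ :* b″ :+ b′ :* a″) :+ b :* (a′ :* a″ :+ d :* (b′ :* b″))) refl d a b a′ b′ a″ b″)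
    where open ℚ.+-*-Solver

  ·-identityˡ : ∀ x → 1# · x ≡ x
  ·-identityˡ (a , b) = cong₂ _,_
    (solve 3 (λ d a b → con 1ℚ :* a :+ d :* (con 0ℚ :* b) := a) refl d a b)
    (solve 2 (λ a b → con 1ℚ :* b :+ con 0ℚ :* a := b) refl a b)
    where open ℚ.+-*-Solver

  ·-distribˡ-+ : ∀ x y z → x · (y + z) ≡ (x · y) + (x · z)
  ·-distribˡ-+ (a , b) (a′ , b′) (a″ , b″) = cong₂ _,_
    (solve 7 (λ d a b a′ b′ a″ b″ →
      a :* (a′ :+ a″) :+ d :* (b :* (b′ :+ b″)) :=
      (a :* a′ :+ d :* (b :* b′)) :+ (a :* a″ :+ d :* (b :* b″))) refl d a b a′ b′ a″ b″)
    (solve 6 (λ a b a′ b′ a″ b″ →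
      a :* (b′ :+ b″) :+ b :* (a′ :+ a″) :=
      (a :* b′ :+ b :* a′) :+ (a :* b″ :+ b :* a″)) refl a b a′ b′ a″ b″)
    where open ℚ.+-*-Solver

  isCommutativeRing : IsCommutativeRing _≡_ _+_ _·_ -_ 0# 1#
  isCommutativeRing = record
    { isRing = record
      { +-isAbelianGroup = record
        { isGroup = record
          { isMonoid = record
            { isSemigroup = record
              { isMagma = record { isEquivalence = isEquivalence ; ∙-cong = cong₂ _+_ }
              ; assoc = λ (a , b) (a′ , b′) (a″ , b″) →
                  cong₂ _,_ (ℚ.+-assoc a a′ a″) (ℚ.+-assoc b b′ b″)
              }
            ; identity =
                (λ (a , b) → cong₂ _,_ (ℚ.+-identityˡ a) (ℚ.+-identityˡ b)) ,
                (λ (a , b) → cong₂ _,_ (ℚ.+-identityʳ a) (ℚ.+-identityʳ b))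
            }
          ; inverse =
              (λ (a , b) → cong₂ _,_ (ℚ.+-inverseˡ a) (ℚ.+-inverseˡ b)) ,
              (λ (a , b) → cong₂ _,_ (ℚ.+-inverseʳ a) (ℚ.+-inverseʳ b))
          ; ⁻¹-cong = cong -_
          }
        ; comm = λ (a , b) (a′ , b′) → cong₂ _,_ (ℚ.+-comm a a′) (ℚ.+-comm b b′)
        }
      ; *-cong = cong₂ _·_
      ; *-assoc = ·-assoc
      ; *-identity = ·-identityˡ , λ x → trans (·-comm x 1#) (·-identityˡ x)
      ; distrib = ·-distribˡ-+ , λ x y z →
          trans (·-comm (y + z) x)
          (trans (·-distribˡ-+ x y z) (cong₂ _+_ (·-comm x y) (·-comm x z)))
      }
    ; *-comm = ·-comm
    }

  -- Anisotropy of the norm expresses that `d` is not a square in ℚ, which is what makes the algebra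
  -- a field.
  module _ (anisotropic : ∀ x → norm x ≡ 0ℚ → x ≡ 0#) where

    commutativeRing : CommutativeRing _ _
    commutativeRing = record { isCommutativeRing = isCommutativeRing }

    open CommutativeRing commutativeRing using (+-group; zeroˡ; -‿inverseʳ)
    open import Algebra.Properties.Group +-group using (x∙y⁻¹≈ε⇒x≈y)

    -- The inverse is the conjugate divided by the norm, which is nonzero by anisotropy.
    inverse : ∀ x → ¬ x ≡ 0# → ∃ λ y → x · y ≡ 1#
    inverse x@(a , b) x≢0 = (a ℚ.* n⁻¹ , (ℚ.- b) ℚ.* n⁻¹) , cong₂ _,_
      (trans
        (solve 4 (λ d a b n⁻¹ →
          a :* (a :* n⁻¹) :+ d :* (b :* ((:- b) :* n⁻¹)) :=
          (a :* a :- d :* (b :* b)) :* n⁻¹) refl d a b n⁻¹)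
        (ℚ.*-inverseʳ (norm x)))
      (solve 3 (λ a b n⁻¹ → a :* ((:- b) :* n⁻¹) :+ b :* (a :* n⁻¹) := con 0ℚ) refl a b n⁻¹)
      where
      open ℚ.+-*-Solver
      instance n≢0 = ℚ.≢-nonZero (λ eq → x≢0 (anisotropic x eq))
      n⁻¹ = ℚ.1/ norm x

    private
      ≡-decSetoid : DecSetoid _ _
      ≡-decSetoid = decSetoid (≡-dec ℚ._≟_ ℚ._≟_)

    field′ : Field
    field′ = record
      { isHeytingField = record
        { isHeytingCommutativeRing = record
          { isCommutativeRing = isCommutativeRing
          ; isApartnessRelation = DecSetoid.≉-isApartnessRelation ≡-decSetoid
          ; #⇒invertible = λ {x} {y} x≢y →
              let z , eq = inverse (x + - y) (λ e → x≢y (x∙y⁻¹≈ε⇒x≈y x y e))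
              in z , trans (·-comm z (x + - y)) eq , eq
          -- At equal arguments the difference is 0, so an inverse of it would give 1 = 0.
          ; invertible⇒# = λ { {x} (z , _ , eq) refl →
              contradiction
                (trans (sym eq) (trans (cong (_· z) (-‿inverseʳ x)) (zeroˡ z)))
                λ () }
          }
        ; tight = DecSetoid.≉-tight ≡-decSetoid
        }
      }

    embedding : Embedding ℚ.heytingField field′
    embedding = record
      { ⟦_⟧ = λ q → q , 0ℚ
      ; isRingMonomorphism = record
        { isRingHomomorphism = record
          { isSemiringHomomorphism = record
            { isNearSemiringHomomorphism = record
              { +-isMonoidHomomorphism = record
                { isMagmaHomomorphism = record
                  { isRelHomomorphism = record { cong = cong (_, 0ℚ) }
                  ; homo = λ _ _ → refl
                  }
                ; ε-homo = refl
                }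
              ; *-homo = λ p q → cong₂ _,_
                  (solve 3 (λ d p q → p :* q := p :* q :+ d :* (con 0ℚ :* con 0ℚ)) refl d p q)
                  (solve 2 (λ p q → con 0ℚ := p :* con 0ℚ :+ con 0ℚ :* q) refl p q)
              }
            ; 1#-homo = refl
            }
          ; -‿homo = λ _ → refl
          }
        ; injective = cong proj₁
        }
      }
      where open ℚ.+-*-Solver

    basis : Vector Quadratic 2
    basis zero       = 1#
    basis (suc zero) = 0ℚ , 1ℚ

    -- The left side is `combination` unfolded, including the zero that ends the sum. This single
    -- identity yields both independence and spanning.
    combination-basis : ∀ p q →
      (p , 0ℚ) · basis zero + ((q , 0ℚ) · basis (suc zero) + 0#) ≡ (p , q)
    combination-basis p q = cong₂ _,_
      (solve 3 (λ d p q →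
        p :* con 1ℚ :+ d :* (con 0ℚ :* con 0ℚ) :+
          (q :* con 0ℚ :+ d :* (con 0ℚ :* con 1ℚ) :+ con 0ℚ) := p) refl d p q)
      (solve 2 (λ p q →
        p :* con 0ℚ :+ con 0ℚ :* con 1ℚ :+
          (q :* con 1ℚ :+ con 0ℚ :* con 0ℚ :+ con 0ℚ) := q) refl p q)
      where open ℚ.+-*-Solver

    isBasis : IsBasis embedding basis
    isBasis = record
      { independent = λ c eq → λ where
          zero       → cong proj₁ (trans (sym (combination-basis (c zero) (c (suc zero)))) eq)
          (suc zero) → cong proj₂ (trans (sym (combination-basis (c zero) (c (suc zero)))) eq)
      ; spanning = λ (p , q) →
          (λ { zero → p ; (suc zero) → q }) , combination-basis p q
      }

    numberField : NumberField
    numberField = record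
      { asField = field′
      ; ι       = embedding
      ; degree  = 2
      ; basis   = basis
      ; isBasis = isBasis
      }

-- The field ℚ as a number field of degree 1

identityEmbedding : ∀ F → Embedding F F
identityEmbedding F = record
  { ⟦_⟧ = λ x → x
  ; isRingMonomorphism = Identity.isRingMonomorphism (Field.rawRing F) (Field.refl F)
  }
  where import Algebra.Morphism.Construct.Identity as Identity

rationals : NumberField
rationals = record
  { asField = ℚ.heytingField
  ; ι       = identityEmbedding ℚ.heytingField
  ; degree  = 1
  ; basis   = λ _ → 1ℚ
  ; isBasis = record
    { independent = λ c eq → λ where
        zero → trans (sym (combination-1 (c zero))) eq
    ; spanning = λ q → (λ _ → q) , combination-1 q
    }
  }
  where
  combination-1 : ∀ q → q ℚ.* 1ℚ ℚ.+ 0ℚ ≡ q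
  combination-1 q = trans (ℚ.+-identityʳ (q ℚ.* 1ℚ)) (ℚ.*-identityʳ q)

-- The field ℚ(√-7)

square-nonNeg : ∀ p → ℚ.NonNegative (p ℚ.* p)
square-nonNeg p with ℚ.≤-total 0ℚ p
... | inj₁ 0≤p = ℚ.nonNeg*nonNeg⇒nonNeg p p
  where instance _ = ℚ.nonNegative 0≤p
... | inj₂ p≤0 = ℚ.nonPos*nonPos⇒nonPos p p
  where instance _ = ℚ.nonPositive p≤0

square-pos : ∀ {p} → ¬ p ≡ 0ℚ → ℚ.Positive (p ℚ.* p)
square-pos {p} p≢0 = ℚ.nonNeg∧nonZero⇒pos (p ℚ.* p)
  {{square-nonNeg p}} {{ℚ.≢-nonZero (x#0y#0→xy#0 p≢0 p≢0)}}

pos⇒≢0 : ∀ p → .{{ℚ.Positive p}} → ¬ p ≡ 0ℚ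
pos⇒≢0 p p≡0 = ℚ.<⇒≢ (ℚ.positive⁻¹ p) (sym p≡0)

open QuadraticAlgebra (ℤ→ℚ -[1+ 6 ])

-- The norm is a² + 7b², a sum of nonnegative terms, and a nonzero coordinate would make it
-- positive.
anisotropic : ∀ x → norm x ≡ 0ℚ → x ≡ 0#
anisotropic (a , b) norm≡0 = cong₂ _,_ a≡0 b≡0
  where
  instance
    _ = square-nonNeg a
    _ = square-nonNeg b

  7b² : ℚ
  7b² = ℤ→ℚ (+ 7) ℚ.* (b ℚ.* b)

  sum≡0 : a ℚ.* a ℚ.+ 7b² ≡ 0ℚ
  sum≡0 = trans
    (solve 2 (λ a b → a :* a :+ con (ℤ→ℚ (+ 7)) :* (b :* b) :=
                      a :* a :- con (ℤ→ℚ -[1+ 6 ]) :* (b :* b)) refl a b)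
    norm≡0
    where open ℚ.+-*-Solver

  a≡0 : a ≡ 0ℚ
  a≡0 = decidable-stable (a ℚ.≟ 0ℚ) λ a≢0 →
    let instance _ = square-pos a≢0
                 _ = ℚ.nonNeg*nonNeg⇒nonNeg (ℤ→ℚ (+ 7)) (b ℚ.* b)
    in pos⇒≢0 _ {{ℚ.pos+nonNeg⇒pos (a ℚ.* a) 7b²}} sum≡0

  b≡0 : b ≡ 0ℚ
  b≡0 = decidable-stable (b ℚ.≟ 0ℚ) λ b≢0 →
    let instance _ = square-pos b≢0
                 _ = ℚ.pos*pos⇒pos (ℤ→ℚ (+ 7)) (b ℚ.* b)
    in pos⇒≢0 _ {{ℚ.nonNeg+pos⇒pos (a ℚ.* a) 7b²}} sum≡0

ℚ√-7 : NumberField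
ℚ√-7 = numberField anisotropic

module ℚ√-7 = NumberField ℚ√-7

-- Evaluation and leading coefficients of characteristic polynomials

coeff-map : ∀ F k → ℚ[x].coeff (map ℤ→ℚ F) k ≡ ℤ→ℚ (ℤ[x].coeff F k)
coeff-map []      k       = refl
coeff-map (a ∷ F) zero    = refl
coeff-map (a ∷ F) (suc k) = coeff-map F k

eval-≈0 : ∀ F x → F ℤ[x].≈ₚ [] → ℤ[x].eval F x ≡ + 0
eval-≈0 []      x eq = refl
eval-≈0 (a ∷ F) x eq rewrite eq 0 | eval-≈0 F x (λ k → eq (suc k)) =
  trans (ℤ.+-identityˡ (x ℤ.* + 0)) (ℤ.*-zeroʳ x)

-- Equal polynomials may be lists of different lengths; the surplus consists of zeros, which
-- `eval-≈0` handles.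
eval-cong : ∀ F G x → F ℤ[x].≈ₚ G → ℤ[x].eval F x ≡ ℤ[x].eval G x
eval-cong []      G       x eq = sym (eval-≈0 G x (λ k → sym (eq k)))
eval-cong (a ∷ F) []      x eq = eval-≈0 (a ∷ F) x eq
eval-cong (a ∷ F) (b ∷ G) x eq =
  cong₂ (λ c y → c ℤ.+ x ℤ.* y) (eq 0) (eval-cong F G x (λ k → eq (suc k)))

charPoly-coeff : ∀ {n} (M : Matrix ℚ n) F → map ℤ→ℚ F ℚ[x].≈ₚ charPoly M →
  ∀ k z → ℚ[x].coeff (charPoly M) k ≡ ℤ→ℚ z → ℤ[x].coeff F k ≡ z
charPoly-coeff M F eq k z eqk =
  ℤ→ℚ-injective (trans (sym (coeff-map F k)) (trans (eq k) eqk))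

-- From degree 1 on, the coefficients of the determinant involve closed numerals only, so they
-- compute for a variable `M`. The constant term stays unknown; the later difference argument
-- cancels it.
charPoly₁-monic : ∀ (M : Matrix ℚ 1) F → map ℤ→ℚ F ℚ[x].≈ₚ charPoly M →
  F ℤ[x].≈ₚ (ℤ[x].coeff F 0 ∷ + 1 ∷ [])
charPoly₁-monic M F eq 0             = refl
charPoly₁-monic M F eq 1             = charPoly-coeff M F eq 1 (+ 1) refl
charPoly₁-monic M F eq (suc (suc k)) = charPoly-coeff M F eq (suc (suc k)) (+ 0) refl

charPoly₂-monic : ∀ (M : Matrix ℚ 2) F → map ℤ→ℚ F ℚ[x].≈ₚ charPoly M →
  F ℤ[x].≈ₚ (ℤ[x].coeff F 0 ∷ ℤ[x].coeff F 1 ∷ + 1 ∷ [])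
charPoly₂-monic M F eq 0                   = refl
charPoly₂-monic M F eq 1                   = refl
charPoly₂-monic M F eq 2                   = charPoly-coeff M F eq 2 (+ 1) refl
charPoly₂-monic M F eq (suc (suc (suc k))) = charPoly-coeff M F eq (suc (suc (suc k))) (+ 0) refl

-- The element (1 + √-7)/2 and its index

θ : ℚ√-7.Carrier
θ = ½ , ½

F-θ : ℤ[x].Poly
F-θ = + 2 ∷ -[1+ 0 ] ∷ + 1 ∷ []

isCharPoly-θ : ℚ√-7.IsCharPoly θ F-θ
isCharPoly-θ 0                   = refl
isCharPoly-θ 1                   = refl
isCharPoly-θ 2                   = refl
isCharPoly-θ (suc (suc (suc k))) = refl

isIntegral-θ : ℚ√-7.IsIntegral θ
isIntegral-θ = + 2 ∷ -[1+ 0 ] ∷ [] , refl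

-- a + b√-7 = (a - b) + 2bθ.
isPrimitive-θ : ℚ√-7.IsPrimitive θ
isPrimitive-θ (a , b) = ℚ√-7.resp
  (cong₂ _,_
    (solve 2 (λ a b → a :- b :+ (con (ℤ→ℚ (+ 2)) :* b :* con ½ :+
        con (ℤ→ℚ -[1+ 6 ]) :* (con 0ℚ :* con ½)) := a) refl a b)
    (solve 1 (λ b → con 0ℚ :+ (con (ℤ→ℚ (+ 2)) :* b :* con ½ :+ con 0ℚ :* con ½) := b) refl b))
  (ℚ√-7.sum (ℚ√-7.rational (a ℚ.- b)) (ℚ√-7.product (ℚ√-7.rational (ℤ→ℚ (+ 2) ℚ.* b)) ℚ√-7.generator))
  where open ℚ.+-*-Solver

-- x² - x = x(x - 1) is always even. The witnesses are the halves of the values at x = 2q and x = 2q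
-- + 1.
2∣F-θ : ∀ x → + 2 ∣ ℤ[x].eval F-θ x
2∣F-θ x with x ℤ.%ℕ 2 | ℤ.a≡a%ℕn+[a/ℕn]*n x 2 | ℤ.n%ℕd<d x 2
... | 0 | eq | _ = divides (+ 1 ℤ.- q ℤ.+ + 2 ℤ.* (q ℤ.* q)) (trans (cong (ℤ[x].eval F-θ) eq)
  (solve 1 (λ q → let x = con (+ 0) :+ q :* con (+ 2) in
    con (+ 2) :+ x :* (con (-[1+ 0 ]) :+ x :* (con (+ 1) :+ x :* con (+ 0))) :=
    (con (+ 1) :- q :+ con (+ 2) :* (q :* q)) :* con (+ 2)) refl q))
  where
  open ℤ.+-*-Solver
  q = x ℤ./ℕ 2
... | 1 | eq | _ = divides (+ 1 ℤ.+ q ℤ.+ + 2 ℤ.* (q ℤ.* q)) (trans (cong (ℤ[x].eval F-θ) eq)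
  (solve 1 (λ q → let x = con (+ 1) :+ q :* con (+ 2) in
    con (+ 2) :+ x :* (con (-[1+ 0 ]) :+ x :* (con (+ 1) :+ x :* con (+ 0))) :=
    (con (+ 1) :+ q :+ con (+ 2) :* (q :* q)) :* con (+ 2)) refl q))
  where
  open ℤ.+-*-Solver
  q = x ℤ./ℕ 2
... | suc (suc _) | _ | ℕ.s≤s (ℕ.s≤s ())

-- All values are even, and the value at 0 is 2 itself, so every common divisor divides 2.
isElementIndex-θ : ℚ√-7.IsElementIndex θ 2
isElementIndex-θ = F-θ , isCharPoly-θ ,
  (λ { _ (x , refl) → ∣⇒∣ᵤ (2∣F-θ x) }) , λ _ d∣F → d∣F 2 (+ 0 , refl)

-- The indices of ℚ and ℚ(√-7)

commonDivisor : ∀ {g} F G → F ℤ[x].≈ₚ G → IsGCD (λ n → ∃ λ x → n ≡ ℤ.∣ ℤ[x].eval F x ∣) g →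
  ∀ x → + g ∣ ℤ[x].eval G x
commonDivisor {g} F G F≈G (g∣F , _) x =
  -- Replacing `F` by an explicit list `G` of the same coefficients lets the ring solver expand the
  -- values.
  subst (+ g ∣_) (eval-cong F G x F≈G) (∣ᵤ⇒∣ (g∣F _ (x , refl)))

-- i(θ) divides F(1) - F(0), which is 1 in degree 1.
elementIndex-rationals : ∀ q {g} → NumberField.IsElementIndex rationals q g → g ℕ.∣ 1
elementIndex-rationals q {g} (F , isCharPoly , isGCD) =
  ∣⇒∣ᵤ (subst (+ g ∣_)
    (solve 1 (λ c → let F = λ x → c :+ x :* (con (+ 1) :+ x :* con (+ 0)) in
      F (con (+ 1)) :- F (con (+ 0)) := con (+ 1)) refl (ℤ[x].coeff F 0))
    (∣m∣n⇒∣m-n (g∣F (+ 1)) (g∣F (+ 0))))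
  where
  open ℤ.+-*-Solver
  g∣F = commonDivisor F (ℤ[x].coeff F 0 ∷ + 1 ∷ [])
    (charPoly₁-monic (NumberField.multiplication rationals q) F isCharPoly) isGCD

-- i(θ) divides F(1) + F(-1) - 2F(0), which is 2 in degree 2.
elementIndex-ℚ√-7 : ∀ x {g} → ℚ√-7.IsElementIndex x g → g ℕ.∣ 2
elementIndex-ℚ√-7 x {g} (F , isCharPoly , isGCD) =
  ∣⇒∣ᵤ (subst (+ g ∣_)
    (solve 2 (λ c d → let F = λ x → c :+ x :* (d :+ x :* (con (+ 1) :+ x :* con (+ 0))) in
      F (con (+ 1)) :+ F (con (-[1+ 0 ])) :- con (+ 2) :* F (con (+ 0)) := con (+ 2))
      refl (ℤ[x].coeff F 0) (ℤ[x].coeff F 1))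
    (∣m∣n⇒∣m-n (∣m∣n⇒∣m+n (g∣F (+ 1)) (g∣F -[1+ 0 ])) (∣n⇒∣m*n (+ 2) (g∣F (+ 0)))))
  where
  open ℤ.+-*-Solver
  g∣F = commonDivisor F (ℤ[x].coeff F 0 ∷ ℤ[x].coeff F 1 ∷ + 1 ∷ [])
    (charPoly₂-monic (ℚ√-7.multiplication x) F isCharPoly) isGCD

isFieldIndex-rationals : NumberField.IsFieldIndex rationals 1
isFieldIndex-rationals =
  (λ { _ (q , _ , _ , isIndex) → elementIndex-rationals q isIndex }) , λ k _ → ℕ.1∣ k

isFieldIndex-ℚ√-7 : ℚ√-7.IsFieldIndex 2
isFieldIndex-ℚ√-7 =
  (λ { _ (x , _ , _ , isIndex) → elementIndex-ℚ√-7 x isIndex }) ,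
  λ _ g∣k → g∣k 2 (θ , isIntegral-θ , isPrimitive-θ , isElementIndex-θ)

-- Integrality at 3, which is inert in ℚ(√-7) because -7 is not a square modulo 3

fromℤ² : ℤ → ℤ → ℚ√-7.Carrier
fromℤ² y z = ℤ→ℚ y , ℤ→ℚ z

-- The norm of `fromℤ² y z`, taken in ℤ so that divisibility by 3 makes sense.
normℤ : ℤ → ℤ → ℤ
normℤ y z = y ℤ.* y ℤ.+ + 7 ℤ.* (z ℤ.* z)

3∣m*n⇒3∣m⊎3∣n : ∀ m n → + 3 ∣ m ℤ.* n → + 3 ∣ m ⊎ + 3 ∣ n
3∣m*n⇒3∣m⊎3∣n m n 3∣mn
  with euclidsLemma ℤ.∣ m ∣ ℤ.∣ n ∣ (from-yes (prime? 3)) (subst (3 ℕ.∣_) (ℤ.abs-* m n) (∣⇒∣ᵤ 3∣mn))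
... | inj₁ 3∣m = inj₁ (∣ᵤ⇒∣ 3∣m)
... | inj₂ 3∣n = inj₂ (∣ᵤ⇒∣ 3∣n)

-- By residues: for z = 3q + 1 and z = 3q + 2 the witnesses are (z² - 1)/3.
square-mod-3 : ∀ z → + 3 ∣ z ⊎ + 3 ∣ z ℤ.* z ℤ.- + 1
square-mod-3 z with z ℤ.%ℕ 3 | ℤ.a≡a%ℕn+[a/ℕn]*n z 3 | ℤ.n%ℕd<d z 3
... | 0 | eq | _ = inj₁ (divides (z ℤ./ℕ 3) (trans eq (ℤ.+-identityˡ _)))
... | 1 | eq | _ = inj₂ (divides (+ 2 ℤ.* q ℤ.+ + 3 ℤ.* (q ℤ.* q)) (trans (cong (λ z → z ℤ.* z ℤ.- + 1) eq)
  (solve 1 (λ q → let z = con (+ 1) :+ q :* con (+ 3) in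
    z :* z :- con (+ 1) := (con (+ 2) :* q :+ con (+ 3) :* (q :* q)) :* con (+ 3)) refl q)))
  where
  open ℤ.+-*-Solver
  q = z ℤ./ℕ 3
... | 2 | eq | _ = inj₂ (divides (+ 1 ℤ.+ + 4 ℤ.* q ℤ.+ + 3 ℤ.* (q ℤ.* q)) (trans (cong (λ z → z ℤ.* z ℤ.- + 1) eq)
  (solve 1 (λ q → let z = con (+ 2) :+ q :* con (+ 3) in
    z :* z :- con (+ 1) :=
    (con (+ 1) :+ con (+ 4) :* q :+ con (+ 3) :* (q :* q)) :* con (+ 3)) refl q)))
  where
  open ℤ.+-*-Solver
  q = z ℤ./ℕ 3
... | suc (suc (suc _)) | _ | ℕ.s≤s (ℕ.s≤s (ℕ.s≤s ()))

-- Squares are 0 or 1 modulo 3 and 7 is 1, so y² + 7z² vanishes modulo 3 only if both squares do. In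
-- the other cases, removing multiples of 3 leaves 7, 1 or 8.
3∣normℤ⇒3∣ : ∀ y z → + 3 ∣ normℤ y z → + 3 ∣ y × + 3 ∣ z
3∣normℤ⇒3∣ y z 3∣N with square-mod-3 y | square-mod-3 z
... | inj₁ 3∣y    | inj₁ 3∣z    = 3∣y , 3∣z
... | inj₁ 3∣y    | inj₂ 3∣z²-1 = contradiction
  (∣⇒∣ᵤ (subst (+ 3 ∣_)
    (solve 2 (λ y z → y :* y :+ con (+ 7) :* (z :* z) :- y :* y :-
      con (+ 7) :* (z :* z :- con (+ 1)) := con (+ 7)) refl y z)
    (∣m∣n⇒∣m-n (∣m∣n⇒∣m-n 3∣N (∣m⇒∣m*n y 3∣y)) (∣n⇒∣m*n (+ 7) 3∣z²-1))))
  (from-no (3 ℕ.∣? 7))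
  where open ℤ.+-*-Solver
... | inj₂ 3∣y²-1 | inj₁ 3∣z    = contradiction
  (∣⇒∣ᵤ (subst (+ 3 ∣_)
    (solve 2 (λ y z → y :* y :+ con (+ 7) :* (z :* z) :- (y :* y :- con (+ 1)) :-
      con (+ 7) :* (z :* z) := con (+ 1)) refl y z)
    (∣m∣n⇒∣m-n (∣m∣n⇒∣m-n 3∣N 3∣y²-1) (∣n⇒∣m*n (+ 7) (∣m⇒∣m*n z 3∣z)))))
  (from-no (3 ℕ.∣? 1))
  where open ℤ.+-*-Solver
... | inj₂ 3∣y²-1 | inj₂ 3∣z²-1 = contradiction
  (∣⇒∣ᵤ (subst (+ 3 ∣_)
    (solve 2 (λ y z → y :* y :+ con (+ 7) :* (z :* z) :- (y :* y :- con (+ 1)) :-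
      con (+ 7) :* (z :* z :- con (+ 1)) := con (+ 8)) refl y z)
    (∣m∣n⇒∣m-n (∣m∣n⇒∣m-n 3∣N 3∣y²-1) (∣n⇒∣m*n (+ 7) 3∣z²-1))))
  (from-no (3 ℕ.∣? 8))
  where open ℤ.+-*-Solver

fromℤ²-+ : ∀ t u w → ℚ√-7.fromℤ t + fromℤ² u w ≡ fromℤ² (t ℤ.+ u) w
fromℤ²-+ t u w = cong₂ _,_ (sym (ℤ→ℚ-+ t u)) (ℚ.+-identityˡ (ℤ→ℚ w))

fromℤ²-· : ∀ y z u w →
  fromℤ² y z · fromℤ² u w ≡ fromℤ² (y ℤ.* u ℤ.+ -[1+ 6 ] ℤ.* (z ℤ.* w)) (y ℤ.* w ℤ.+ z ℤ.* u)
fromℤ²-· y z u w = sym (cong₂ _,_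
  (trans (ℤ→ℚ-+ (y ℤ.* u) (-[1+ 6 ] ℤ.* (z ℤ.* w)))
    (cong₂ ℚ._+_ (ℤ→ℚ-* y u)
      (trans (ℤ→ℚ-* -[1+ 6 ] (z ℤ.* w)) (cong (ℤ→ℚ -[1+ 6 ] ℚ.*_) (ℤ→ℚ-* z w)))))
  (trans (ℤ→ℚ-+ (y ℤ.* w) (z ℤ.* u)) (cong₂ ℚ._+_ (ℤ→ℚ-* y w) (ℤ→ℚ-* z u))))

fromℤ-* : ∀ y z → ℚ√-7.fromℤ (y ℤ.* z) ≡ ℚ√-7.fromℤ y · ℚ√-7.fromℤ z
fromℤ-* y z = trans (cong (_, 0ℚ) (ℤ→ℚ-* y z))
  (Embedding.isRingMonomorphism (NumberField.ι ℚ√-7) .*-homo (ℤ→ℚ y) (ℤ→ℚ z))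
  where open IsRingMonomorphism

evalMonic : List ℤ → ℚ√-7.Carrier → ℚ√-7.Carrier
evalMonic f = Polynomial.eval ℚ√-7.rawRing (map ℚ√-7.fromℤ (f ++ [ + 1 ]))

-- Modulo 3, the multiple D ^ n · f(γ) of the value at γ of a monic f of degree n
-- is (D · γ) ^ n.
scaled-evalMonic : ∀ {γ D} y z → + 3 ∣ D → ¬ + 3 ∣ normℤ y z → ℚ√-7.fromℤ D · γ ≡ fromℤ² y z →
  ∀ f → ∃ λ s → ∃₂ λ u w → ¬ + 3 ∣ normℤ u w × ℚ√-7.fromℤ s · evalMonic f γ ≡ fromℤ² u w
-- The empty list encodes the monic constant 1, whose norm is 1.
scaled-evalMonic {γ} _ _ 3∣D 3∤N eq [] = + 1 , + 1 , + 0 , (λ 3∣1 → from-no (3 ℕ.∣? 1) (∣⇒∣ᵤ 3∣1)) ,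
  trans (ℚ√-7.*-identityˡ (1# + γ · 0#)) (trans (cong (λ x → 1# + x) (ℚ√-7.zeroʳ γ)) (ℚ√-7.+-identityʳ 1#))
scaled-evalMonic {γ} {D} y z 3∣D 3∤N eq (a ∷ f)
  with s , u , w , 3∤N′ , eq′ ← scaled-evalMonic y z 3∣D 3∤N eq f =
  -- One Horner step: Ds(a + γE) = Dsa + (Dγ)(sE). The first summand is `t`, a multiple of 3; the
  -- second is U + V√-7.
  D ℤ.* s , t ℤ.+ U , V , 3∤N″ , eq″
  where
  t = D ℤ.* s ℤ.* a
  U = y ℤ.* u ℤ.+ -[1+ 6 ] ℤ.* (z ℤ.* w)
  V = y ℤ.* w ℤ.+ z ℤ.* u
  E = evalMonic f γ

  3∤N″ : ¬ + 3 ∣ normℤ (t ℤ.+ U) V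
  3∤N″ 3∣N″ = contradiction
    (3∣m*n⇒3∣m⊎3∣n (normℤ y z) (normℤ u w)
      (∣m+n∣m⇒∣n
        (subst (+ 3 ∣_)
          -- The norm is multiplicative, so U² + 7V² = N(y, z)N(u, w); shifting U by `t` adds t(t +
          -- 2U), a multiple of `D`.
          (solve 7 (λ D s a y z u w →
            let t = D :* s :* a
                U = y :* u :+ con -[1+ 6 ] :* (z :* w)
                V = y :* w :+ z :* u
                N = λ y z → y :* y :+ con (+ 7) :* (z :* z)
            in N (t :+ U) V := D :* (s :* a :* (t :+ con (+ 2) :* U)) :+ N y z :* N u w)
            refl D s a y z u w)
          3∣N″)
        (∣m⇒∣m*n (s ℤ.* a ℤ.* (t ℤ.+ + 2 ℤ.* U)) 3∣D)))
    λ { (inj₁ 3∣N) → 3∤N 3∣N ; (inj₂ 3∣N′) → 3∤N′ 3∣N′ }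
    where open ℤ.+-*-Solver

  open ≡-Reasoning
  open import Algebra.Properties.CommutativeSemigroup ℚ√-7.*-commutativeSemigroup using (interchange)

  eq″ : ℚ√-7.fromℤ (D ℤ.* s) · (ℚ√-7.fromℤ a + γ · E) ≡ fromℤ² (t ℤ.+ U) V
  eq″ = begin
    ℚ√-7.fromℤ (D ℤ.* s) · (ℚ√-7.fromℤ a + γ · E)
      ≡⟨ ℚ√-7.distribˡ (ℚ√-7.fromℤ (D ℤ.* s)) (ℚ√-7.fromℤ a) (γ · E) ⟩
    ℚ√-7.fromℤ (D ℤ.* s) · ℚ√-7.fromℤ a + ℚ√-7.fromℤ (D ℤ.* s) · (γ · E)
      ≡⟨ cong₂ _+_ (sym (fromℤ-* (D ℤ.* s) a)) (cong (_· (γ · E)) (fromℤ-* D s)) ⟩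
    ℚ√-7.fromℤ t + (ℚ√-7.fromℤ D · ℚ√-7.fromℤ s) · (γ · E)
      -- Regrouping pairs D with γ and s with E, as the hypothesis and the induction require.
      ≡⟨ cong (λ x → ℚ√-7.fromℤ t + x) (interchange (ℚ√-7.fromℤ D) (ℚ√-7.fromℤ s) γ E) ⟩
    ℚ√-7.fromℤ t + (ℚ√-7.fromℤ D · γ) · (ℚ√-7.fromℤ s · E)
      ≡⟨ cong₂ (λ x x′ → ℚ√-7.fromℤ t + x · x′) eq eq′ ⟩
    ℚ√-7.fromℤ t + fromℤ² y z · fromℤ² u w
      ≡⟨ cong (λ x → ℚ√-7.fromℤ t + x) (fromℤ²-· y z u w) ⟩
    ℚ√-7.fromℤ t + fromℤ² U V
      ≡⟨ fromℤ²-+ t U V ⟩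
    fromℤ² (t ℤ.+ U) V
      ∎

-- At a root the scaled value is 0, so u = w = 0 and the norm is divisible by 3 after all.
not-integral : ∀ {γ D} y z → + 3 ∣ D → ¬ + 3 ∣ normℤ y z → ℚ√-7.fromℤ D · γ ≡ fromℤ² y z →
  ¬ ℚ√-7.IsIntegral γ
not-integral y z 3∣D 3∤N eq (f , f[γ]≡0)
  with s , u , w , 3∤N′ , eq′ ← scaled-evalMonic y z 3∣D 3∤N eq f =
  3∤N′ (subst (+ 3 ∣_) (cong₂ normℤ 0≡u 0≡w) (divides (+ 0) refl))
  where
  0≡ : 0# ≡ fromℤ² u w
  0≡ = trans (sym (trans (cong (ℚ√-7.fromℤ s ·_) f[γ]≡0) (ℚ√-7.zeroʳ (ℚ√-7.fromℤ s)))) eq′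
  0≡u = ℤ→ℚ-injective {+ 0} {u} (cong proj₁ 0≡)
  0≡w = ℤ→ℚ-injective {+ 0} {w} (cong proj₂ 0≡)

-- θ is not congruent to a rational number modulo 3

↧p*p≡↥p : ∀ p → ℤ→ℚ (ℚ.↧ p) ℚ.* p ≡ ℤ→ℚ (ℚ.↥ p)
↧p*p≡↥p p@record{} = ℚ.toℚᵘ-injective (begin
  ℚ.toℚᵘ (ℤ→ℚ (ℚ.↧ p) ℚ.* p)              ≈⟨ ℚ.toℚᵘ-homo-* (ℤ→ℚ (ℚ.↧ p)) p ⟩
  ℚ.toℚᵘ (ℤ→ℚ (ℚ.↧ p)) ℚᵘ.* ℚ.toℚᵘ p      ≈⟨ ℚᵘ.*-congʳ (toℚᵘ-ℤ→ℚ (ℚ.↧ p)) ⟩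
  mkℚᵘ (ℚ.↧ p) 0 ℚᵘ.* ℚ.toℚᵘ p            ≈⟨ *≡* (solve 2
    (λ n d → d :* n :* con (+ 1) := n :* (con (+ 1) :* d)) refl (ℚ.↥ p) (ℚ.↧ p)) ⟩
  mkℚᵘ (ℚ.↥ p) 0                          ≈⟨ toℚᵘ-ℤ→ℚ (ℚ.↥ p) ⟨
  ℚ.toℚᵘ (ℤ→ℚ (ℚ.↥ p))                    ∎)
  where
  open ℚᵘ.≃-Reasoning
  open ℤ.+-*-Solver

-- The coprimality proof stored in a rational is irrelevant, so it is recomputed by decidability.
↥-↧-coprime : ∀ p → Coprime ℤ.∣ ℚ.↥ p ∣ (ℚ.↧ₙ p)
↥-↧-coprime (mkℚ _ _ coprime) = Coprimality.recompute coprime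

-- With α = u/w in lowest terms and γ = (θ - α)/3, one has 6wγ = (w - 2u) + w√-7. If 3 divided the
-- norm of the right side, it would divide both `w` and `u`.
θ-not-rational-mod-3 : ∀ α → ¬ (θ ℚ√-7.≡ (α , 0ℚ) mod 3)
θ-not-rational-mod-3 α (γ , isIntegral , θ-α≡3γ) =
  not-integral (w ℤ.+ -[1+ 1 ] ℤ.* u) w
    (∣n⇒∣m*n (+ 2 ℤ.* w) ∣-refl) 3∤N eq isIntegral
  where
  u = ℚ.↥ α
  w = ℚ.↧ α

  3∤N : ¬ + 3 ∣ normℤ (w ℤ.+ -[1+ 1 ] ℤ.* u) w
  3∤N 3∣N with 3∣y , 3∣w ← 3∣normℤ⇒3∣ (w ℤ.+ -[1+ 1 ] ℤ.* u) w 3∣N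
    -- From 3 dividing w - 2u and w it follows that 3 divides -2u.
    with 3∣m*n⇒3∣m⊎3∣n -[1+ 1 ] u (∣m+n∣m⇒∣n 3∣y 3∣w)
  ... | inj₁ 3∣2 = from-no (3 ℕ.∣? 2) (∣⇒∣ᵤ 3∣2)
  ... | inj₂ 3∣u = contradiction (↥-↧-coprime α (∣⇒∣ᵤ 3∣u , ∣⇒∣ᵤ 3∣w)) λ ()

  open ≡-Reasoning

  eq : ℚ√-7.fromℤ (+ 2 ℤ.* w ℤ.* + 3) · γ ≡ fromℤ² (w ℤ.+ -[1+ 1 ] ℤ.* u) w
  eq = begin
    ℚ√-7.fromℤ (+ 2 ℤ.* w ℤ.* + 3) · γ
      ≡⟨ cong (_· γ) (fromℤ-* (+ 2 ℤ.* w) (+ 3)) ⟩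
    ℚ√-7.fromℤ (+ 2 ℤ.* w) · ℚ√-7.fromℤ (+ 3) · γ
      ≡⟨ ℚ√-7.*-assoc (ℚ√-7.fromℤ (+ 2 ℤ.* w)) (ℚ√-7.fromℤ (+ 3)) γ ⟩
    ℚ√-7.fromℤ (+ 2 ℤ.* w) · (ℚ√-7.fromℤ (+ 3) · γ)
      ≡⟨ cong₂ (λ x x′ → (x , 0ℚ) · x′) (ℤ→ℚ-* (+ 2) w) (sym θ-α≡3γ) ⟩
    (ℤ→ℚ (+ 2) ℚ.* ℤ→ℚ w , 0ℚ) · (½ ℚ.- α , ½ ℚ.- 0ℚ)
      ≡⟨ cong₂ _,_
        (solve 2 (λ w α → con (ℤ→ℚ (+ 2)) :* w :* (con ½ :- α) :+
           con (ℤ→ℚ -[1+ 6 ]) :* (con 0ℚ :* (con ½ :- con 0ℚ)) :=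
           w :+ con (ℤ→ℚ -[1+ 1 ]) :* (w :* α)) refl (ℤ→ℚ w) α)
        (solve 2 (λ w α → con (ℤ→ℚ (+ 2)) :* w :* (con ½ :- con 0ℚ) :+
           con 0ℚ :* (con ½ :- α) := w) refl (ℤ→ℚ w) α) ⟩
    (ℤ→ℚ w ℚ.+ ℤ→ℚ -[1+ 1 ] ℚ.* (ℤ→ℚ w ℚ.* α) , ℤ→ℚ w)
      -- The denominator clears here: wα = u.
      ≡⟨ cong (λ q → (ℤ→ℚ w ℚ.+ ℤ→ℚ -[1+ 1 ] ℚ.* q , ℤ→ℚ w)) (↧p*p≡↥p α) ⟩
    (ℤ→ℚ w ℚ.+ ℤ→ℚ -[1+ 1 ] ℚ.* ℤ→ℚ u , ℤ→ℚ w)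
      ≡⟨ cong (λ q → (ℤ→ℚ w ℚ.+ q , ℤ→ℚ w)) (ℤ→ℚ-* -[1+ 1 ] u) ⟨
    (ℤ→ℚ w ℚ.+ ℤ→ℚ (-[1+ 1 ] ℤ.* u) , ℤ→ℚ w)
      ≡⟨ cong (_, ℤ→ℚ w) (ℤ→ℚ-+ w (-[1+ 1 ] ℤ.* u)) ⟨
    fromℤ² (w ℤ.+ -[1+ 1 ] ℤ.* u) w
      ∎
    where open ℚ.+-*-Solver

-- The counterexample: ℚ inside ℚ(√-7) with p = 3

mainTheorem8 : Σ NumberFieldExtension λ L → let open NumberFieldExtension L in
    ∃ λ (p : ℕ) → Prime p ×
    ∃ λ (i₁ : ℕ) → ∃ λ (i : ℕ) →
    K₁.IsFieldIndex i₁ × K.IsFieldIndex i ×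
    ExactlyOne
    (m * v p i₁ ≡ v p i)
    ((β : K.Carrier) → K.IsIntegral β →
    (g : ℕ) → K.IsElementIndex β g → v p g ≡ v p i →
    ∃ λ (α : K₁.Carrier) → K₁.IsIntegral α × (β K.≡ include α mod p))
mainTheorem8 =
  record
    { K₁     = rationals
    ; K      = ℚ√-7
    ; σ      = NumberField.ι ℚ√-7
    ; m      = 2
    ; [K:K₁] = basis anisotropic , isBasis anisotropic
    } ,
  3 , from-yes (prime? 3) , 1 , 2 , isFieldIndex-rationals , isFieldIndex-ℚ√-7 ,
  -- Condition (1) computes to 0 = 0, as 3 divides neither 1 nor 2. Condition (2) is refuted at β =
  -- θ, whose index equals that of the field.
  inj₁ (refl , λ lift → let α , _ , θ≡α = lift θ isIntegral-θ 2 isElementIndex-θ refl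
                        in θ-not-rational-mod-3 α θ≡α)
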